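{- Let $\Sigma$ be a finite alphabet of non-negative integer letters containing the letter $0$, with $a=|\Sigma|\ge 2$. Let $1\le m<n$ be integers and write $n=km+r$ with $r=n\bmod m$, and assume $r\ne 0$. Put $m_1=r$, $n_1=(k+1)r$, $m_2=m-r$, $n_2=k(m-r)$, $N_1=a^{n_1}$, $N_2=a^{n_2}$. For $j=1,2$ let $\tau_j$ be an $m_j$-shift de Bruijn sequence of order $n_j$ over $\Sigma$ whose prefix of length $n_j$ is $0^{n_j}$, and let $w_j=\tau_j0^{m_j}$. Define $$u_i=w_1[n_1+(i-1)m_1+1\,..\,n_1+im_1]\quad(1\le i\le N_1),\qquad v_i=w_2[n_2+(i-1)m_2+1\,..\,n_2+im_2]\quad(1\le i\le N_2),$$ and, for $i\ge 1$, $$u'_i=u_{1+(i\bmod (N_1-1))},\qquad v'_i=v_{1+((i-1)\bmod N_2)}.$$ Then the word $$0^{n}\;v_10^{m_1}\;v_20^{m_1}\cdots v_{N_2-1}0^{m_1}\;v_{N_2}u'_{(N_1-1)N_2}\;v'_1u'_1\;v'_2u'_2\cdots v'_{(N_1-1)N_2-1}u'_{(N_1-1)N_2-1}$$ is an $m$-shift de Bruijn sequence of order $n$ over $\Sigma$.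
   Context: $\Sigma^n$ denotes the set of all words of length $n$ over $\Sigma$, juxtaposition denotes concatenation, and $0^t$ is the word consisting of $t$ zeros. For a word $w=a_1a_2\cdots a_\ell$, write $w[i..j]=a_i\cdots a_j$. A word $u$ of length $n$ appears in $w$ (as a factor) at a modulo $m$ position if $u=w[im+1..im+n]$ for some integer $i\ge 0$; distinct values of $i$ count as distinct appearances. An $m$-shift de Bruijn sequence of order $n$ over $\Sigma$ is a word $w$ over $\Sigma$, of length $m|\Sigma|^n+(n-m)$, such that each word in $\Sigma^n$ appears exactly once in $w$ as a factor at a modulo $m$ position. -}

module Defs where

open import Data.Nat using (ℕ; suc; _+_; _*_; _∸_; _^_; _≤_; z≤n; s≤s; NonZero; >-nonZero)
open import Data.Nat.DivMod using (_%_)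
open import Data.Nat.Properties using (≤-trans; *-mono-≤; m≤n+m; n≢0⇒n>0; ^-monoʳ-<; m<n⇒0<n∸m; m^n≢0)
open import Data.List using (List; _++_; length; take; drop; replicate; concat; applyUpTo)
open import Data.List.Membership.Propositional using (_∈_)
open import Data.List.Relation.Unary.All using (All)
open import Data.Product using (_×_; ∃!)
open import Function using (_∘_)
open import Relation.Binary.PropositionalEquality using (_≡_; _≢_)

-- Letters are natural numbers.  An alphabet is a duplicate-free list of
-- letters (duplicate-freeness is assumed where it is used), so that its
-- cardinality is the length of the list; the order of the list plays no role.
Word : Set
Word = List ℕ

_WordOver_ : Word → List ℕ → Set
w WordOver Σ = All (_∈ Σ) w

0^_ : ℕ → Word
0^ t = replicate t 0

-- 1-based and inclusive at both ends, for 1 ≤ i ≤ j ≤ length w.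
_[_⋯_] : Word → ℕ → ℕ → Word
w [ i ⋯ j ] = take (suc j ∸ i) (drop (i ∸ 1) w)

-- The bound keeps the factor inside w; `take` and `drop` would otherwise
-- truncate silently.
AppearsAtModulo : ℕ → Word → Word → ℕ → Set
AppearsAtModulo m w u i =
  i * m + length u ≤ length w × u ≡ w [ i * m + 1 ⋯ i * m + length u ]

record IsShiftDeBruijn (Σ : List ℕ) (m n : ℕ) (w : Word) : Set where
  field
    wordOver    : w WordOver Σ
    -- Truncated subtraction applied last: this is the integer
    -- m |Σ|ⁿ + (n − m) even when n < m, for nonempty Σ.
    lengthIs    : length w ≡ (m * length Σ ^ n + n) ∸ m
    appearsOnce : ∀ u → u WordOver Σ → length u ≡ n →
                  ∃! _≡_ (AppearsAtModulo m w u)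

-- f 1 ++ f 2 ++ ⋯ ++ f t
concat[1⋯_] : ℕ → (ℕ → Word) → Word
concat[1⋯ t ] f = concat (applyUpTo (f ∘ suc) t)

-- The two hypotheses 2 ≤ |Σ| and r ≢ 0 serve only to make N₁ ∸ 1 and N₂ legal
-- moduli in u′ and v′.
module Construction (Σ : List ℕ) (2≤a : 2 ≤ length Σ)
                    (m n k r : ℕ) (r≢0 : r ≢ 0)
                    (τ₁ τ₂ : Word) where

  a m₁ n₁ m₂ n₂ N₁ N₂ : ℕ
  a  = length Σ
  m₁ = r
  n₁ = (k + 1) * r
  m₂ = m ∸ r
  n₂ = k * (m ∸ r)
  N₁ = a ^ n₁
  N₂ = a ^ n₂

  instance
    N₁∸1-nonZero : NonZero (N₁ ∸ 1)
    N₁∸1-nonZero = >-nonZero (m<n⇒0<n∸m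
      (^-monoʳ-< a 2≤a (*-mono-≤ (m≤n+m 1 k) (n≢0⇒n>0 r≢0))))

    N₂-nonZero : NonZero N₂
    N₂-nonZero = m^n≢0 a n₂ {{>-nonZero (≤-trans (s≤s z≤n) 2≤a)}}

  w₁ w₂ : Word
  w₁ = τ₁ ++ 0^ m₁
  w₂ = τ₂ ++ 0^ m₂

  u v u′ v′ : ℕ → Word
  u i  = w₁ [ n₁ + (i ∸ 1) * m₁ + 1 ⋯ n₁ + i * m₁ ]
  v i  = w₂ [ n₂ + (i ∸ 1) * m₂ + 1 ⋯ n₂ + i * m₂ ]
  u′ i = u (1 + i % (N₁ ∸ 1))
  v′ i = v (1 + (i ∸ 1) % N₂)

  word : Word
  word = 0^ n
      ++ concat[1⋯ N₂ ∸ 1 ] (λ i → v i ++ 0^ m₁)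
      ++ v N₂ ++ u′ ((N₁ ∸ 1) * N₂)
      ++ concat[1⋯ (N₁ ∸ 1) * N₂ ∸ 1 ] (λ i → v′ i ++ u′ i)

{-# OPTIONS --safe #-}

-- Cut the word into blocks of alternating lengths r and m − r.  A window of
-- length n at a modulo m position consists of k + 1 blocks of the first kind
-- and k of the second, so it amounts to a pair of windows, one of w₁ and one of
-- w₂.  As τ₁ and τ₂ return to the all-zero word, the second kind of blocks
-- traverses the cyclic sequence of w₂ with period N₂.  The first kind stays at
-- the zero window for the first N₂ positions and afterwards traverses the
-- nonzero windows of w₁ with period N₁ − 1.  Since N₁ − 1 and N₂ are coprime,
-- every pair of windows occurs exactly once by the Chinese remainder theorem.
module Submission where

open import Defs
open import Data.Nat
open import Data.Nat.Properties
open import Data.Nat.DivMod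
open import Data.Nat.Divisibility
open import Data.Nat.Coprimality using (Coprime; coprime-divisor; coprime-Bézout)
import Data.Nat.Coprimality as Coprimality
open import Data.Nat.GCD using (module Bézout)
open import Data.Nat.Tactic.RingSolver using (solve-∀)
open import Data.List using (List; []; _∷_; _++_; length; take; drop; concat; applyUpTo)
open import Data.List.Properties
  using ( ++-assoc; ∷-injectiveˡ; ∷-injectiveʳ; applyUpTo-∷ʳ; map-applyUpTo
        ; length-++; length-take; length-drop; length-replicate
        ; take-all; take-take; take-drop; drop-drop; take++drop≡id)
open import Data.List.Relation.Unary.All using ([])
import Data.List.Relation.Unary.All.Properties as All
open import Data.List.Membership.Propositional using (_∈_)
open import Data.List.Membership.Propositional.Properties using (∈-applyUpTo⁺; ∈-applyUpTo⁻)
open import Data.List.Membership.Propositional.Properties.WithK using (unique∧set⇒bag)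
open import Data.List.Relation.Unary.Unique.Propositional using (Unique)
import Data.List.Relation.Unary.Unique.Propositional.Properties as Unique
open import Data.List.Relation.Binary.BagAndSetEquality using (∼bag⇒↭)
open import Data.List.Relation.Binary.Permutation.Propositional
  using (_↭_; ↭-sym; ↭-trans; swap; ↭-refl; ↭-reflexive)
open import Data.List.Relation.Binary.Permutation.Propositional.Properties
  using (drop-∷; ↭-singleton-inv; ∷↭∷ʳ) renaming (map⁺ to ↭-map⁺)
open import Data.Product using (_×_; _,_; proj₁; proj₂; ∃; ∃₂; ∃!)
open import Function using (_∘_; mk⇔)
open import Relation.Nullary using (yes; no; contradiction)
open import Relation.Binary.PropositionalEquality

-- Pairing the two full cycles directly would fail: their periods `N₁` and `N₂` are both powers of
-- `a`, so they are not coprime. The zero window of the first cycle is the one to sacrifice. Its run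
-- of k + 1 zero blocks occurs once per round; deleting one block of the run removes exactly that
-- window and leaves the period N₁ - 1, which is prime to `a`. The pairs lost are those whose first
-- window is zero. One extra round of the second cycle, spent on zeros, supplies them, and N₂ + (N₁
-- - 1) N₂ = aⁿ. There is no seam between the two phases, because the shortened cycle itself begins
-- with k zero blocks. The return of τ₁ and τ₂ to zero is not part of their definition, which is not
-- cyclic and prescribes only a prefix here. It is forced by a count over all words of length n,
-- carried out in `Closed`.

private variable
  A : Set

-- Factors, concatenations and blocks of words

++-injective : {xs ys us vs : List A} → length xs ≡ length ys →
               xs ++ us ≡ ys ++ vs → xs ≡ ys × us ≡ vs
++-injective {xs = []}     {[]}     _  eq = refl , eq
++-injective {xs = x ∷ xs} {y ∷ ys} le eq
  with refl ← ∷-injectiveˡ eq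
  with refl , us≡vs ← ++-injective {xs = xs} {ys} (suc-injective le) (∷-injectiveʳ eq) = refl , us≡vs

take-++ : ∀ {p} (xs : List A) {ys} → length xs ≡ p → take p (xs ++ ys) ≡ xs
take-++ []       refl = refl
take-++ (x ∷ xs) refl = cong (x ∷_) (take-++ xs refl)

drop-++ : ∀ {p} (xs : List A) {ys} → length xs ≡ p → drop p (xs ++ ys) ≡ ys
drop-++ []       refl = refl
drop-++ (x ∷ xs) refl = drop-++ xs refl

take-+ : ∀ p q (xs : List A) → take (p + q) xs ≡ take p xs ++ take q (drop p xs)
take-+ zero    q xs       = refl
take-+ (suc p) zero    [] = refl
take-+ (suc p) (suc q) [] = refl
take-+ (suc p) q (x ∷ xs) = cong (x ∷_) (take-+ p q xs)

take-++ˡ : ∀ p (xs ys : List A) → p ≤ length xs → take p (xs ++ ys) ≡ take p xs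
take-++ˡ zero    xs       ys _       = refl
take-++ˡ (suc p) (x ∷ xs) ys (s≤s h) = cong (x ∷_) (take-++ˡ p xs ys h)

drop-++ˡ : ∀ p (xs ys : List A) → p ≤ length xs → drop p (xs ++ ys) ≡ drop p xs ++ ys
drop-++ˡ zero    xs       ys _       = refl
drop-++ˡ (suc p) (x ∷ xs) ys (s≤s h) = drop-++ˡ p xs ys h

length-factor : ∀ p q (xs : List A) → p + q ≤ length xs → length (take q (drop p xs)) ≡ q
length-factor p q xs h = begin
  length (take q (drop p xs))  ≡⟨ length-take q (drop p xs) ⟩
  q ⊓ length (drop p xs)       ≡⟨ cong (q ⊓_) (length-drop p xs) ⟩
  q ⊓ (length xs ∸ p)          ≡⟨ m≤n⇒m⊓n≡m (m+n≤o⇒m≤o∸n q (subst (_≤ length xs) (+-comm p q) h)) ⟩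
  q                            ∎
  where open ≡-Reasoning

0^-+ : ∀ p q → 0^ (p + q) ≡ 0^ p ++ 0^ q
0^-+ zero    q = refl
0^-+ (suc p) q = cong (0 ∷_) (0^-+ p q)

cat : (ℕ → Word) → ℕ → Word
cat f t = concat (applyUpTo f t)

cat-cong : ∀ {f g} t → (∀ i → i < t → f i ≡ g i) → cat f t ≡ cat g t
cat-cong zero    h = refl
cat-cong (suc t) h = cong₂ _++_ (h 0 z<s) (cat-cong t (λ i i<t → h (suc i) (s<s i<t)))

cat-+ : ∀ f s t → cat f (s + t) ≡ cat f s ++ cat (f ∘ (s +_)) t
cat-+ f zero    t = refl
cat-+ f (suc s) t = trans (cong (f 0 ++_) (cat-+ (f ∘ suc) s t))
                          (sym (++-assoc (f 0) (cat (f ∘ suc) s) (cat (f ∘ (suc s +_)) t)))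

length-cat : ∀ {f ℓ} t → (∀ i → i < t → length (f i) ≡ ℓ) → length (cat f t) ≡ t * ℓ
length-cat zero    h = refl
length-cat {f} (suc t) h = trans (length-++ (f 0))
  (cong₂ _+_ (h 0 z<s) (length-cat t (λ i i<t → h (suc i) (s<s i<t))))

cat-injective : ∀ {f g} t → (∀ i → i < t → length (f i) ≡ length (g i)) →
                cat f t ≡ cat g t → ∀ i → i < t → f i ≡ g i
cat-injective (suc t) h eq zero    _   = proj₁ (++-injective (h 0 z<s) eq)
cat-injective {f} {g} (suc t) h eq (suc i) (s<s i<t) =
  cat-injective {f ∘ suc} {g ∘ suc} t (λ j j<t → h (suc j) (s<s j<t))
    (proj₂ (++-injective {xs = f 0} {g 0} (h 0 z<s) eq)) i i<t

cat-0^ : ∀ ℓ t → cat (λ _ → 0^ ℓ) t ≡ 0^ (t * ℓ)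
cat-0^ ℓ zero    = refl
cat-0^ ℓ (suc t) = trans (cong (0^ ℓ ++_) (cat-0^ ℓ t)) (sym (0^-+ ℓ (t * ℓ)))

block : ℕ → Word → ℕ → Word
block ℓ w j = take ℓ (drop (j * ℓ) w)

cat-block : ∀ ℓ w t → cat (block ℓ w) t ≡ take (t * ℓ) w
cat-block ℓ w zero    = refl
cat-block ℓ w (suc t) = begin
  take ℓ w ++ cat (block ℓ w ∘ suc) t
    ≡⟨ cong (take ℓ w ++_) (cat-cong t λ i _ → cong (take ℓ) (sym (drop-drop ℓ (i * ℓ) w))) ⟩
  take ℓ w ++ cat (block ℓ (drop ℓ w)) t   ≡⟨ cong (take ℓ w ++_) (cat-block ℓ (drop ℓ w) t) ⟩
  take ℓ w ++ take (t * ℓ) (drop ℓ w)      ≡⟨ take-+ ℓ (t * ℓ) w ⟨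
  take (ℓ + t * ℓ) w                       ∎
  where open ≡-Reasoning

cat-block-shift : ∀ ℓ w j t → cat (block ℓ w ∘ (j +_)) t ≡ take (t * ℓ) (drop (j * ℓ) w)
cat-block-shift ℓ w j t = trans
  (cat-cong t λ i _ → cong (take ℓ) (trans (cong (λ p → drop p w) (*-distribʳ-+ ℓ j i))
                                           (sym (drop-drop (j * ℓ) (i * ℓ) w))))
  (cat-block ℓ (drop (j * ℓ) w) t)

block-over : ∀ {Σ} ℓ w j → w WordOver Σ → block ℓ w j WordOver Σ
block-over ℓ w j w∈ = All.take⁺ ℓ (All.drop⁺ (j * ℓ) w∈)

length-block : ∀ ℓ w t j → length w ≡ t * ℓ → j < t → length (block ℓ w j) ≡ ℓ
length-block ℓ w t j lw j<t = length-factor (j * ℓ) ℓ w (begin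
  j * ℓ + ℓ   ≡⟨ +-comm (j * ℓ) ℓ ⟩
  suc j * ℓ   ≤⟨ *-monoˡ-≤ ℓ j<t ⟩
  t * ℓ       ≡⟨ lw ⟨
  length w    ∎)
  where open ≤-Reasoning

-- Alternating words

-- Begins and ends with a `U`-block, matching n = r + k (s + r): both the whole word and each of its
-- windows have this shape.
alt : (U V : ℕ → Word) → ℕ → Word
alt U V t = U 0 ++ cat (λ j → V j ++ U (suc j)) t

alt-suc : ∀ U V t → alt U V (suc t) ≡ (U 0 ++ V 0) ++ alt (U ∘ suc) (V ∘ suc) t
alt-suc U V t = begin
  U 0 ++ (V 0 ++ U 1) ++ c  ≡⟨ cong (U 0 ++_) (++-assoc (V 0) (U 1) c) ⟩
  U 0 ++ V 0 ++ U 1 ++ c    ≡⟨ ++-assoc (U 0) (V 0) (U 1 ++ c) ⟨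
  (U 0 ++ V 0) ++ U 1 ++ c  ∎
  where
  open ≡-Reasoning
  c = cat (λ j → V (suc j) ++ U (suc (suc j))) t

alt-+ : ∀ U V s t → alt U V (s + t) ≡ alt U V s ++ cat (λ j → V (s + j) ++ U (suc (s + j))) t
alt-+ U V s t = trans (cong (U 0 ++_) (cat-+ (λ j → V j ++ U (suc j)) s t))
                      (sym (++-assoc (U 0) (cat _ s) (cat _ t)))

alt-cong : ∀ {U U′ V V′} t → (∀ i → i < suc t → U i ≡ U′ i) → (∀ i → i < t → V i ≡ V′ i) →
           alt U V t ≡ alt U′ V′ t
alt-cong t hU hV = cong₂ _++_ (hU 0 z<s)
  (cat-cong t λ i i<t → cong₂ _++_ (hV i i<t) (hU (suc i) (s<s i<t)))

module _ {r s : ℕ} where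

  length-alt : ∀ U V t → (∀ i → length (U i) ≡ r) → (∀ i → length (V i) ≡ s) →
               length (alt U V t) ≡ r + t * (s + r)
  length-alt U V t hU hV = trans (length-++ (U 0)) (cong₂ _+_ (hU 0)
    (length-cat t λ i _ → trans (length-++ (V i)) (cong₂ _+_ (hV i) (hU (suc i)))))

  drop-alt : ∀ U V i t → (∀ j → length (U j) ≡ r) → (∀ j → length (V j) ≡ s) →
             drop (i * (s + r)) (alt U V (i + t)) ≡ alt (U ∘ (i +_)) (V ∘ (i +_)) t
  drop-alt U V zero    t hU hV = refl
  drop-alt U V (suc i) t hU hV = begin
    drop ((s + r) + i * (s + r)) (alt U V (suc i + t))
      ≡⟨ drop-drop (s + r) (i * (s + r)) _ ⟨
    drop (i * (s + r)) (drop (s + r) (alt U V (suc i + t)))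
      ≡⟨ cong (λ x → drop (i * (s + r)) (drop (s + r) x)) (alt-suc U V (i + t)) ⟩
    drop (i * (s + r)) (drop (s + r) ((U 0 ++ V 0) ++ rest))
      ≡⟨ cong (drop (i * (s + r))) (drop-++ (U 0 ++ V 0) len) ⟩
    drop (i * (s + r)) rest
      ≡⟨ drop-alt (U ∘ suc) (V ∘ suc) i t (hU ∘ suc) (hV ∘ suc) ⟩
    alt (U ∘ (suc i +_)) (V ∘ (suc i +_)) t ∎
    where
    open ≡-Reasoning
    rest = alt (U ∘ suc) (V ∘ suc) (i + t)
    len : length (U 0 ++ V 0) ≡ s + r
    len = trans (length-++ (U 0)) (trans (cong₂ _+_ (hU 0) (hV 0)) (+-comm r s))

  factor-alt : ∀ U V i t e → (∀ j → length (U j) ≡ r) → (∀ j → length (V j) ≡ s) →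
               take (r + t * (s + r)) (drop (i * (s + r)) (alt U V (i + (t + e)))) ≡
               alt (U ∘ (i +_)) (V ∘ (i +_)) t
  factor-alt U V i t e hU hV = begin
    take (r + t * (s + r)) (drop (i * (s + r)) (alt U V (i + (t + e))))
      ≡⟨ cong (take _) (drop-alt U V i (t + e) hU hV) ⟩
    take (r + t * (s + r)) (alt (U ∘ (i +_)) (V ∘ (i +_)) (t + e))
      ≡⟨ cong (take _) (alt-+ (U ∘ (i +_)) (V ∘ (i +_)) t e) ⟩
    take (r + t * (s + r)) (window ++ rest)
      ≡⟨ take-++ window (length-alt (U ∘ (i +_)) (V ∘ (i +_)) t (hU ∘ (i +_)) (hV ∘ (i +_))) ⟩
    window ∎
    where
    open ≡-Reasoning
    window = alt (U ∘ (i +_)) (V ∘ (i +_)) t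
    rest = cat (λ j → V (i + (t + j)) ++ U (i + suc (t + j))) e

  -- The alternation of `alt`, but read off two plain words. A window thus depends on its blocks
  -- only through their two concatenations, and the correspondence between words of length n and
  -- pairs of words can be stated without block sequences. The base case keeps all of `x`, which is
  -- then the last block.
  weave : ℕ → Word → Word → Word
  weave zero    x y = x
  weave (suc t) x y = (take r x ++ take s y) ++ weave t (drop r x) (drop s y)

  alt≡weave : ∀ U V t → (∀ i → length (U i) ≡ r) → (∀ i → length (V i) ≡ s) →
              alt U V t ≡ weave t (cat U (suc t)) (cat V t)
  alt≡weave U V zero    hU hV = refl
  alt≡weave U V (suc t) hU hV = begin
    alt U V (suc t)                                   ≡⟨ alt-suc U V t ⟩
    (U 0 ++ V 0) ++ alt (U ∘ suc) (V ∘ suc) t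
      ≡⟨ cong ((U 0 ++ V 0) ++_) (alt≡weave (U ∘ suc) (V ∘ suc) t (hU ∘ suc) (hV ∘ suc)) ⟩
    (U 0 ++ V 0) ++ weave t cU cV
      ≡⟨ cong₂ _++_ (cong₂ _++_ (take-++ (U 0) (hU 0)) (take-++ (V 0) (hV 0)))
                    (cong₂ (weave t) (drop-++ (U 0) (hU 0)) (drop-++ (V 0) (hV 0))) ⟨
    weave (suc t) (U 0 ++ cU) (V 0 ++ cV) ∎
    where
    open ≡-Reasoning
    cU = cat (U ∘ suc) (suc t)
    cV = cat (V ∘ suc) t

  length-take-suc : ∀ ℓ t (x : Word) → length x ≡ suc t * ℓ → length (take ℓ x) ≡ ℓ
  length-take-suc ℓ t x lx = length-factor 0 ℓ x (subst (ℓ ≤_) (sym lx) (m≤m+n ℓ (t * ℓ)))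

  length-drop-suc : ∀ ℓ t (x : Word) → length x ≡ suc t * ℓ → length (drop ℓ x) ≡ t * ℓ
  length-drop-suc ℓ t x lx = trans (length-drop ℓ x) (trans (cong (_∸ ℓ) lx) (m+n∸m≡n ℓ (t * ℓ)))

  split-injective : ∀ ℓ t {x x′ y y′ : Word} → length x ≡ suc t * ℓ → length x′ ≡ suc t * ℓ →
    take ℓ x ++ y ≡ take ℓ x′ ++ y′ → take ℓ x ≡ take ℓ x′ × y ≡ y′
  split-injective ℓ t {x} {x′} lx lx′ =
    ++-injective (trans (length-take-suc ℓ t x lx) (sym (length-take-suc ℓ t x′ lx′)))

  weave-injective : ∀ t {x x′ y y′} → length x ≡ suc t * r → length x′ ≡ suc t * r →
                    length y ≡ t * s → length y′ ≡ t * s →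
                    weave t x y ≡ weave t x′ y′ → x ≡ x′ × y ≡ y′
  weave-injective zero    {y = []} {[]} _ _ _ _ eq = eq , refl
  weave-injective (suc t) {x} {x′} {y} {y′} lx lx′ ly ly′ eq
    with ex , eq₁ ← split-injective r (suc t) {x} {x′} lx lx′
           (trans (sym (++-assoc (take r x) (take s y) _)) (trans eq (++-assoc (take r x′) (take s y′) _)))
    with ey , eq₂ ← split-injective s t {y} {y′} ly ly′ eq₁
    with fx , fy ← weave-injective t (length-drop-suc r (suc t) x lx) (length-drop-suc r (suc t) x′ lx′)
                                     (length-drop-suc s t y ly) (length-drop-suc s t y′ ly′) eq₂
    = glue r ex fx , glue s ey fy
    where
    glue : ∀ ℓ {z z′ : Word} → take ℓ z ≡ take ℓ z′ → drop ℓ z ≡ drop ℓ z′ → z ≡ z′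
    glue ℓ {z} {z′} p q = trans (sym (take++drop≡id ℓ z)) (trans (cong₂ _++_ p q) (take++drop≡id ℓ z′))

  weave-surjective : ∀ {Σ} t z → z WordOver Σ → length z ≡ r + t * (s + r) →
    ∃₂ λ x y → (x WordOver Σ × length x ≡ suc t * r) × (y WordOver Σ × length y ≡ t * s) × z ≡ weave t x y
  weave-surjective zero    z z∈ lz = z , [] , (z∈ , lz) , ([] , refl) , refl
  weave-surjective (suc t) z z∈ lz
    with x , y , (x∈ , lx) , (y∈ , ly) , eq ← weave-surjective t (drop (r + s) z) (All.drop⁺ (r + s) z∈)
      (trans (length-drop (r + s) z) (trans (cong (_∸ (r + s)) (trans lz
        (trans (cong (r +_) (+-assoc s r (t * (s + r)))) (sym (+-assoc r s _))))) (m+n∸m≡n (r + s) _)))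
    = z₁ ++ x , z₂ ++ y
    , (All.++⁺ (All.take⁺ r z∈) x∈ , trans (length-++ z₁) (cong₂ _+_ l₁ lx))
    , (All.++⁺ (All.take⁺ s (All.drop⁺ r z∈)) y∈ , trans (length-++ z₂) (cong₂ _+_ l₂ ly))
    , (begin
      z                                         ≡⟨ take++drop≡id (r + s) z ⟨
      take (r + s) z ++ drop (r + s) z          ≡⟨ cong₂ _++_ (take-+ r s z) eq ⟩
      (z₁ ++ z₂) ++ weave t x y
        ≡⟨ cong₂ _++_ (cong₂ _++_ (take-++ z₁ l₁) (take-++ z₂ l₂)) (cong₂ (weave t) (drop-++ z₁ l₁) (drop-++ z₂ l₂)) ⟨
      weave (suc t) (z₁ ++ x) (z₂ ++ y)         ∎)
    where
    open ≡-Reasoning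
    z₁ = take r z
    z₂ = take s (drop r z)
    bound : r + s ≤ length z
    bound = subst (r + s ≤_) (sym lz) (+-monoʳ-≤ r (≤-trans (m≤m+n s r) (m≤m+n (s + r) (t * (s + r)))))
    l₁ : length z₁ ≡ r
    l₁ = length-factor 0 r z (≤-trans (m≤m+n r s) bound)
    l₂ : length z₂ ≡ s
    l₂ = length-factor r s z bound

-- Residues

-- The hypothesis makes the first `k` values reappear after one period. As `k ≤ N`, an argument
-- below `N + k` passes the end at most once, so a single subtraction of `N` reduces it.
%-wraparound : ∀ {f : ℕ → A} N k .{{_ : NonZero N}} → k ≤ N →
               (∀ j → j < k → f (N + j) ≡ f j) → ∀ p → p < N + k → f (p % N) ≡ f p
%-wraparound {f = f} N k k≤N f-per p p<N+k with p <? N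
... | yes p<N = cong f (m<n⇒m%n≡m p<N)
... | no  p≮N = begin
  f (p % N)         ≡⟨ cong (λ x → f (x % N)) N+q≡p ⟨
  f ((N + q) % N)   ≡⟨ cong (λ x → f (x % N)) (+-comm N q) ⟩
  f ((q + N) % N)   ≡⟨ cong f ([m+n]%n≡m%n q N) ⟩
  f (q % N)         ≡⟨ cong f (m<n⇒m%n≡m (<-≤-trans q<k k≤N)) ⟩
  f q               ≡⟨ f-per q q<k ⟨
  f (N + q)         ≡⟨ cong f N+q≡p ⟩
  f p               ∎
  where
  open ≡-Reasoning
  q = p ∸ N
  N+q≡p : N + q ≡ p
  N+q≡p = m+[n∸m]≡n (≮⇒≥ p≮N)
  q<k : q < k
  q<k = +-cancelˡ-< N q k (subst (_< N + k) (sym N+q≡p) p<N+k)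

[m%d+n]%d≡[m+n]%d : ∀ m n d .{{_ : NonZero d}} → (m % d + n) % d ≡ (m + n) % d
[m%d+n]%d≡[m+n]%d m n d = begin
  (m % d + n) % d          ≡⟨ %-distribˡ-+ (m % d) n d ⟩
  (m % d % d + n % d) % d  ≡⟨ cong (λ x → (x + n % d) % d) (m%n%n≡m%n m d) ⟩
  (m % d + n % d) % d      ≡⟨ %-distribˡ-+ m n d ⟨
  (m + n) % d              ∎
  where open ≡-Reasoning

[m+n%d]%d≡[m+n]%d : ∀ m n d .{{_ : NonZero d}} → (m + n % d) % d ≡ (m + n) % d
[m+n%d]%d≡[m+n]%d m n d = begin
  (m + n % d) % d  ≡⟨ cong (_% d) (+-comm m (n % d)) ⟩
  (n % d + m) % d  ≡⟨ [m%d+n]%d≡[m+n]%d n m d ⟩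
  (n + m) % d      ≡⟨ cong (_% d) (+-comm n m) ⟩
  (m + n) % d      ∎
  where open ≡-Reasoning

%-≡-shift : ∀ {x y} b c d .{{_ : NonZero d}} → x + b * d ≡ y + c * d → x % d ≡ y % d
%-≡-shift {x} {y} b c d eq = trans (sym ([m+kn]%n≡m%n x b d)) (trans (cong (_% d) eq) ([m+kn]%n≡m%n y c d))

%-≡⇒∣∸ : ∀ {x y} d .{{_ : NonZero d}} → x % d ≡ y % d → d ∣ y ∸ x
%-≡⇒∣∸ {x} {y} d eq = divides (y / d ∸ x / d) (begin
  y ∸ x                                          ≡⟨ cong₂ _∸_ (m≡m%n+[m/n]*n y d) (m≡m%n+[m/n]*n x d) ⟩
  (y % d + y / d * d) ∸ (x % d + x / d * d)      ≡⟨ cong (λ e → (y % d + y / d * d) ∸ (e + x / d * d)) eq ⟩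
  (y % d + y / d * d) ∸ (y % d + x / d * d)      ≡⟨ [m+n]∸[m+o]≡n∸o (y % d) _ _ ⟩
  y / d * d ∸ x / d * d                          ≡⟨ *-distribʳ-∸ d (y / d) (x / d) ⟨
  (y / d ∸ x / d) * d                            ∎)
  where open ≡-Reasoning

coprime-*-∣ : ∀ {i j d} → Coprime i j → i ∣ d → j ∣ d → i * j ∣ d
coprime-*-∣ {i} {j} c (divides t refl) j∣ =
  subst (_∣ t * i) (*-comm j i) (*-monoˡ-∣ i (coprime-divisor (Coprimality.sym c) (subst (j ∣_) (*-comm t i) j∣)))

coprime-inverse : ∀ N M .{{_ : NonZero N}} → Coprime N M →
                  ∃ λ c → ∃₂ λ e e′ → c * M + e * N ≡ 1 + e′ * N
coprime-inverse N@(suc n) M cop with coprime-Bézout cop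
... | Bézout.-+ x y eq = y , 0 , x , trans (+-identityʳ (y * M)) (sym eq)
-- Here -y is the inverse of `M` modulo `N`; since n = N - 1 is -1 modulo `N`, it is represented by
-- `y * n`.
... | Bézout.+- x y eq = y * n , 1 , x * n , (begin
  y * n * M + 1 * suc n     ≡⟨ lemma₁ y n M ⟩
  1 + n * (1 + y * M)       ≡⟨ cong (λ z → 1 + n * z) eq ⟩
  1 + n * (x * suc n)       ≡⟨ lemma₂ n x ⟩
  1 + x * n * suc n         ∎)
  where
  open ≡-Reasoning
  lemma₁ : ∀ y n M → y * n * M + 1 * suc n ≡ 1 + n * (1 + y * M)
  lemma₁ = solve-∀
  lemma₂ : ∀ n x → 1 + n * (x * suc n) ≡ 1 + x * n * suc n
  lemma₂ = solve-∀

crt-existence : ∀ N M .{{_ : NonZero N}} .{{_ : NonZero M}} → Coprime N M →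
                ∀ {p q} → p < N → q < M → ∃ λ j → j < N * M × j % N ≡ p × j % M ≡ q
crt-existence N@(suc n) M@(suc _) cop {p} {q} p<N q<M
  with c , e , e′ , inverse ← coprime-inverse N M cop
  = residues (p + n * q) c e e′ inverse refl
  where
  open ≡-Reasoning
  residues : ∀ x c e e′ → c * M + e * N ≡ 1 + e′ * N → x ≡ p + n * q →
             ∃ λ j → j < N * M × j % N ≡ p × j % M ≡ q
  residues x c e e′ inverse x≡ = j % (N * M) , m%n<n j (N * M)
    , (begin
      j % (N * M) % N  ≡⟨ m∣n⇒o%n%m≡o%m N (N * M) j (m∣m*n M) ⟩
      j % N            ≡⟨ %-≡-shift (x * e) (q + x * e′) N solution ⟩
      p % N            ≡⟨ m<n⇒m%n≡m p<N ⟩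
      p                ∎)
    , (begin
      j % (N * M) % M  ≡⟨ m∣n⇒o%n%m≡o%m M (N * M) j (n∣m*n N) ⟩
      j % M            ≡⟨ [m+kn]%n≡m%n q (x * c) M ⟩
      q % M            ≡⟨ m<n⇒m%n≡m q<M ⟩
      q                ∎)
    where
    -- Modulo `N` the number x = p + n q is p - q, because n = N - 1, and `c * M` is 1. So the added
    -- term turns q into p modulo `N` and vanishes modulo `M`.
    j = q + x * c * M
    factor-out : ∀ q x c e M N → q + x * c * M + x * e * N ≡ q + x * (c * M + e * N)
    factor-out = solve-∀
    collect : ∀ p q n x e′ → q + (p + n * q) + x * e′ * suc n ≡ p + (q + x * e′) * suc n
    collect = solve-∀
    expand : ∀ q x e′ N → q + x * (1 + e′ * N) ≡ q + x + x * e′ * N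
    expand = solve-∀
    solution : j + x * e * N ≡ p + (q + x * e′) * N
    solution = begin
      j + x * e * N                        ≡⟨ factor-out q x c e M N ⟩
      q + x * (c * M + e * N)              ≡⟨ cong (λ z → q + x * z) inverse ⟩
      q + x * (1 + e′ * N)                 ≡⟨ expand q x e′ N ⟩
      q + x + x * e′ * N                   ≡⟨ cong (λ z → q + z + x * e′ * N) x≡ ⟩
      q + (p + n * q) + x * e′ * N         ≡⟨ collect p q n x e′ ⟩
      p + (q + x * e′) * N                 ∎

-- `N * M` divides the truncated differences in both directions, and both are smaller than `N * M`.
-- Hence both are zero.
crt-uniqueness : ∀ N M .{{_ : NonZero N}} .{{_ : NonZero M}} → Coprime N M →
                 ∀ {i j} → i < N * M → j < N * M → i % N ≡ j % N → i % M ≡ j % M → i ≡ j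
crt-uniqueness N M cop {i} {j} i< j< eqN eqM =
  ≤-antisym (bounded i< (sym eqN) (sym eqM)) (bounded j< eqN eqM)
  where
  bounded : ∀ {i j} → j < N * M → i % N ≡ j % N → i % M ≡ j % M → j ≤ i
  bounded {i} {j} j< eqN eqM with j ∸ i in eq | coprime-*-∣ cop (%-≡⇒∣∸ {i} {j} N eqN) (%-≡⇒∣∸ {i} {j} M eqM)
  ... | zero  | _  = m∸n≡0⇒m≤n eq
  ... | suc d | NM∣ = contradiction (≤-trans (∣⇒≤ NM∣) (subst (_≤ j) eq (m∸n≤m j i))) (<⇒≱ j<)

-- Since `a` divides N + 1, a common divisor of `N` and `a` divides 1. A common divisor of `N` and
-- `a ^ q` is therefore prime to `a`, and the factors `a` can be stripped one at a time.
coprime-pred-^ : ∀ {N} a p q → suc N ≡ a ^ suc p → Coprime N (a ^ q)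
coprime-pred-^ a p zero    eq (_ , d∣1) = ∣1⇒≡1 d∣1
coprime-pred-^ {N} a p (suc q) eq {d} (d∣N , d∣a*a^q) = coprime-pred-^ a p q eq
  (d∣N , coprime-divisor {d} {a} (λ (e∣d , e∣a) → coprime-a (∣-trans e∣d d∣N , e∣a)) d∣a*a^q)
  where
  coprime-a : Coprime N a
  coprime-a {e} (e∣N , e∣a) = ∣1⇒≡1 (∣m+n∣m⇒∣n
    (subst (e ∣_) (trans (sym eq) (+-comm 1 N)) (∣m⇒∣m*n (a ^ p) e∣a)) e∣N)

-- Shift de Bruijn sequences

factor≡ : ∀ w p ℓ → w [ p + 1 ⋯ p + ℓ ] ≡ take ℓ (drop p w)
factor≡ w p ℓ = cong₂ (λ x y → take x (drop y w))
  (trans (cong (suc (p + ℓ) ∸_) (+-comm p 1)) (m+n∸m≡n p ℓ)) (m+n∸n≡m p 1)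

module _ {m n N-1 : ℕ} {w u : Word} .{{_ : NonZero m}} (lw : length w ≡ N-1 * m + n) (lu : length u ≡ n) where

  appears⁺ : ∀ {i} → i ≤ N-1 → u ≡ take n (drop (i * m) w) → AppearsAtModulo m w u i
  appears⁺ {i} i≤ eq = subst₂ _≤_ (cong (i * m +_) (sym lu)) (sym lw) (+-monoˡ-≤ n (*-monoˡ-≤ m i≤))
    , trans eq (trans (cong (λ ℓ → take ℓ (drop (i * m) w)) (sym lu)) (sym (factor≡ w (i * m) (length u))))

  appears⁻ : ∀ {i} → AppearsAtModulo m w u i → i ≤ N-1 × u ≡ take n (drop (i * m) w)
  -- With the length in the form N-1 * m + n, cancelling n and then m turns the condition that the
  -- factor fits into a bound on its index.
  appears⁻ {i} (fits , eq) = *-cancelʳ-≤ i N-1 m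
      (+-cancelʳ-≤ n (i * m) (N-1 * m) (subst₂ _≤_ (cong (i * m +_) lu) lw fits))
    , trans eq (trans (factor≡ w (i * m) (length u)) (cong (λ ℓ → take ℓ (drop (i * m) w)) lu))

length-rotate : ∀ p (x : Word) → length (drop p x ++ take p x) ≡ length x
length-rotate p x = begin
  length (drop p x ++ take p x)            ≡⟨ length-++ (drop p x) ⟩
  length (drop p x) + length (take p x)    ≡⟨ +-comm (length (drop p x)) _ ⟩
  length (take p x) + length (drop p x)    ≡⟨ length-++ (take p x) ⟨
  length (take p x ++ drop p x)            ≡⟨ cong length (take++drop≡id p x) ⟩
  length x                                 ∎
  where open ≡-Reasoning

∷-cancelʳ-↭ : ∀ {x y : A} zs → x ∷ zs ↭ y ∷ zs → x ≡ y
∷-cancelʳ-↭ []       perm = ∷-injectiveˡ (↭-singleton-inv perm)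
∷-cancelʳ-↭ {x = x} {y} (z ∷ zs) perm = ∷-cancelʳ-↭ zs
  (drop-∷ (↭-trans (swap z x ↭-refl) (↭-trans perm (swap y z ↭-refl))))

-- The terms `g 1` to `g t` stand on both sides; cancelling them leaves one term on each.
applyUpTo-↭-shift : ∀ (g : ℕ → A) t → applyUpTo g (suc t) ↭ applyUpTo (g ∘ suc) (suc t) → g (suc t) ≡ g 0
applyUpTo-↭-shift g t perm = sym (∷-cancelʳ-↭ gs (↭-trans perm
  (↭-trans (↭-reflexive (sym (applyUpTo-∷ʳ (g ∘ suc) t))) (↭-sym (∷↭∷ʳ (g (suc t)) gs)))))
  where gs = applyUpTo (g ∘ suc) t

module Closed {Σ : List ℕ} {m p N-1 : ℕ} {τ : Word} .{{_ : NonZero m}} (N≡ : suc N-1 ≡ length Σ ^ (m + p))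
              (τ-dB : IsShiftDeBruijn Σ m (m + p) τ) where

  open IsShiftDeBruijn τ-dB

  n = m + p

  length-τ : length τ ≡ N-1 * m + n
  length-τ = begin
    length τ                        ≡⟨ lengthIs ⟩
    m * length Σ ^ n + n ∸ m        ≡⟨ cong (λ N → m * N + n ∸ m) N≡ ⟨
    m * suc N-1 + n ∸ m             ≡⟨ cong (λ x → x + n ∸ m) (*-comm m (suc N-1)) ⟩
    m + N-1 * m + n ∸ m             ≡⟨ cong (_∸ m) (+-assoc m (N-1 * m) n) ⟩
    m + (N-1 * m + n) ∸ m           ≡⟨ m+n∸m≡n m (N-1 * m + n) ⟩
    N-1 * m + n                     ∎
    where open ≡-Reasoning

  window : ℕ → Word
  window i = take n (drop (i * m) τ)

  window-over : ∀ i → window i WordOver Σ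
  window-over i = All.take⁺ n (All.drop⁺ (i * m) wordOver)

  length-window : ∀ {i} → i < suc N-1 → length (window i) ≡ n
  length-window {i} (s≤s i≤) = length-factor (i * m) n τ
    (subst (i * m + n ≤_) (sym length-τ) (+-monoˡ-≤ n (*-monoˡ-≤ m i≤)))

  window-injective : ∀ {i j} → i < suc N-1 → j < suc N-1 → window i ≡ window j → i ≡ j
  window-injective {i} {j} i<@(s≤s i≤) (s≤s j≤) eq
    with _ , _ , unique ← appearsOnce (window i) (window-over i) (length-window i<)
    = trans (sym (unique (appears⁺ length-τ lu i≤ refl))) (unique (appears⁺ length-τ lu j≤ eq))
    where lu = length-window i<

  window-surjective : ∀ {x} → x WordOver Σ → length x ≡ n → ∃ λ i → i < suc N-1 × x ≡ window i
  window-surjective x∈ lx with i , app , _ ← appearsOnce _ x∈ lx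
    with i≤ , eq ← appears⁻ length-τ lx app = i , s≤s i≤ , eq

  rotate : Word → Word
  rotate x = drop p x ++ take p x

  length-drop-p : ∀ {x : Word} → length x ≡ n → length (drop p x) ≡ m
  length-drop-p {x} lx = trans (length-drop p x) (trans (cong (_∸ p) lx) (m+n∸n≡m m p))

  rotate-injective : ∀ {x y} → length x ≡ n → length y ≡ n → rotate x ≡ rotate y → x ≡ y
  rotate-injective {x} {y} lx ly eq
    with eq₁ , eq₂ ← ++-injective {xs = drop p x} {drop p y}
                         (trans (length-drop-p {x} lx) (sym (length-drop-p {y} ly))) eq
    = trans (sym (take++drop≡id p x)) (trans (cong₂ _++_ eq₂ eq₁) (take++drop≡id p y))

  -- The words of length n are permuted by rotation, so the p-letter suffixes of
  -- the windows are a permutation of their p-letter prefixes; but the suffix of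
  -- each window is the prefix of the next.
  windows-rotate : applyUpTo window (suc N-1) ↭ applyUpTo (rotate ∘ window) (suc N-1)
  windows-rotate = ∼bag⇒↭ (unique∧set⇒bag
    (Unique.applyUpTo⁺₁ window (suc N-1) λ i<j j<N eq →
      <⇒≢ i<j (window-injective (<-trans i<j j<N) j<N eq))
    (Unique.applyUpTo⁺₁ (rotate ∘ window) (suc N-1) λ i<j j<N eq →
      <⇒≢ i<j (window-injective (<-trans i<j j<N) j<N
        (rotate-injective (length-window (<-trans i<j j<N)) (length-window j<N) eq)))
    (mk⇔ to from))
    where
    to : ∀ {x} → x ∈ applyUpTo window (suc N-1) → x ∈ applyUpTo (rotate ∘ window) (suc N-1)
    to {x} x∈ with i , i<N , refl ← ∈-applyUpTo⁻ window x∈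
      -- Moving the first `m` letters to the end inverts `rotate` on words of length m + p.
      with j , j<N , eq ← window-surjective {drop m x ++ take m x}
        (All.++⁺ (All.drop⁺ m (window-over i)) (All.take⁺ m (window-over i)))
        (trans (length-rotate m x) (length-window i<N))
      = subst (_∈ applyUpTo (rotate ∘ window) (suc N-1))
          (trans (cong rotate (sym eq)) (trans
            (cong₂ _++_ (drop-++ (drop m x) lp) (take-++ (drop m x) lp)) (take++drop≡id m x)))
          (∈-applyUpTo⁺ (rotate ∘ window) j<N)
      where
      lp : length (drop m x) ≡ p
      lp = trans (length-drop m x) (trans (cong (_∸ m) (length-window i<N)) (m+n∸m≡n m p))
    from : ∀ {x} → x ∈ applyUpTo (rotate ∘ window) (suc N-1) → x ∈ applyUpTo window (suc N-1)
    from x∈ with i , i<N , refl ← ∈-applyUpTo⁻ (rotate ∘ window) x∈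
      with j , j<N , eq ← window-surjective {rotate (window i)}
        (All.++⁺ (All.drop⁺ p (window-over i)) (All.take⁺ p (window-over i)))
        (trans (length-rotate p (window i)) (length-window i<N))
      = subst (_∈ applyUpTo window (suc N-1)) (sym eq) (∈-applyUpTo⁺ window j<N)

  -- Removing `m` letters from every word in `windows-rotate` leaves the prefixes with indices 0 to
  -- `N-1` on one side and 1 to `suc N-1` on the other. All but the two extreme ones cancel.
  suffix≡prefix : drop (suc N-1 * m) τ ≡ take p τ
  suffix≡prefix = begin
    drop (suc N-1 * m) τ            ≡⟨ take-all p _ (≤-reflexive lp) ⟨
    take p (drop (suc N-1 * m) τ)   ≡⟨ applyUpTo-↭-shift prefix N-1 prefixes↭suffixes ⟩
    take p τ                        ∎
    where
    open ≡-Reasoning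
    prefix : ℕ → Word
    prefix i = take p (drop (i * m) τ)
    lp : length (drop (suc N-1 * m) τ) ≡ p
    lp = trans (length-drop (suc N-1 * m) τ) (trans (cong (_∸ suc N-1 * m) (trans length-τ
      (trans (sym (+-assoc (N-1 * m) m p)) (cong (_+ p) (+-comm (N-1 * m) m))))) (m+n∸m≡n (suc N-1 * m) p))
    drop-window : ∀ i → drop m (window i) ≡ prefix (suc i)
    drop-window i = begin
      drop m (take (m + p) (drop (i * m) τ))  ≡⟨ take-drop p m _ ⟨
      take p (drop m (drop (i * m) τ))        ≡⟨ cong (take p) (drop-drop (i * m) m τ) ⟩
      take p (drop (i * m + m) τ)             ≡⟨ cong (λ x → take p (drop x τ)) (+-comm (i * m) m) ⟩
      prefix (suc i)                          ∎
    drop-rotate : ∀ i → i < suc N-1 → drop m (rotate (window i)) ≡ prefix i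
    drop-rotate i i<N = begin
      drop m (rotate (window i))
        ≡⟨ drop-++ (drop p (window i)) (length-drop-p {window i} (length-window i<N)) ⟩
      take p (take (m + p) (drop (i * m) τ))
        ≡⟨ take-take p (m + p) _ ⟩
      take (p ⊓ (m + p)) (drop (i * m) τ)
        ≡⟨ cong (λ x → take x (drop (i * m) τ)) (m≤n⇒m⊓n≡m (m≤n+m p m)) ⟩
      prefix i ∎
    applyUpTo-cong : ∀ {f g : ℕ → Word} t → (∀ i → i < t → f i ≡ g i) → applyUpTo f t ≡ applyUpTo g t
    applyUpTo-cong zero    h = refl
    applyUpTo-cong (suc t) h = cong₂ _∷_ (h 0 z<s) (applyUpTo-cong t λ i i<t → h (suc i) (s<s i<t))
    prefixes↭suffixes : applyUpTo prefix (suc N-1) ↭ applyUpTo (prefix ∘ suc) (suc N-1)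
    prefixes↭suffixes = subst₂ _↭_
      (trans (map-applyUpTo (rotate ∘ window) (drop m) (suc N-1)) (applyUpTo-cong (suc N-1) drop-rotate))
      (trans (map-applyUpTo window (drop m) (suc N-1)) (applyUpTo-cong (suc N-1) λ i _ → drop-window i))
      (↭-map⁺ (drop m) (↭-sym windows-rotate))

-- Block sequences that begin and end with zeros

take-0^ : ∀ p q → take p (0^ (p + q)) ≡ 0^ p
take-0^ p q = trans (cong (take p) (0^-+ p q)) (take-++ (0^ p) (length-replicate p))

cat-0^⁻ : ∀ {f ℓ} t → (∀ i → i < t → length (f i) ≡ ℓ) → cat f t ≡ 0^ (t * ℓ) → ∀ i → i < t → f i ≡ 0^ ℓ
cat-0^⁻ {f} {ℓ} t hf eq = cat-injective t (λ i i<t → trans (hf i i<t) (sym (length-replicate ℓ)))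
                                          (trans eq (sym (cat-0^ ℓ t)))

module Blocks {Σ : List ℕ} {m t-1 N-1 : ℕ} {τ : Word} .{{_ : NonZero m}}
              (0∈Σ : 0 ∈ Σ)
              (N≡ : suc N-1 ≡ length Σ ^ (suc t-1 * m))
              (τ-dB : IsShiftDeBruijn Σ m (suc t-1 * m) τ)
              (zeros : τ [ 1 ⋯ suc t-1 * m ] ≡ 0^ (suc t-1 * m)) where

  open IsShiftDeBruijn τ-dB using (wordOver)
  open Closed N≡ τ-dB

  t N p : ℕ
  t = suc t-1
  N = suc N-1
  p = t-1 * m

  w : Word
  w = τ ++ 0^ m

  B : ℕ → Word
  B = block m w

  length-w : length w ≡ (N + t) * m
  length-w = begin
    length w                        ≡⟨ length-++ τ ⟩
    length τ + length (0^ m)        ≡⟨ cong₂ _+_ length-τ (length-replicate m) ⟩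
    N-1 * m + t * m + m             ≡⟨ +-comm _ m ⟩
    m + (N-1 * m + t * m)           ≡⟨ cong (m +_) (*-distribʳ-+ m N-1 t) ⟨
    (N + t) * m                     ∎
    where open ≡-Reasoning

  B-over : ∀ j → B j WordOver Σ
  B-over j = block-over m w j (All.++⁺ wordOver (All.replicate⁺ m 0∈Σ))

  length-B : ∀ j → j < N + t → length (B j) ≡ m
  length-B j = length-block m w (N + t) j length-w

  -- These windows end inside `τ`, so the appended zeros do not affect them.
  window≡ : ∀ i → i < N → cat (B ∘ (i +_)) t ≡ window i
  window≡ i (s≤s i≤N-1) = begin
    cat (B ∘ (i +_)) t               ≡⟨ cat-block-shift m w i t ⟩
    take n (drop (i * m) w)          ≡⟨ cong (take n) (drop-++ˡ (i * m) τ (0^ m) (≤-trans (m≤m+n _ n) fits)) ⟩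
    take n (drop (i * m) τ ++ 0^ m)  ≡⟨ take-++ˡ n (drop (i * m) τ) (0^ m)
                                         (subst (n ≤_) (sym (length-drop (i * m) τ)) (m+n≤o⇒m≤o∸n n (subst (_≤ length τ) (+-comm (i * m) n) fits))) ⟩
    window i                         ∎
    where
    open ≡-Reasoning
    fits : i * m + n ≤ length τ
    fits = subst (i * m + n ≤_) (sym length-τ) (+-monoˡ-≤ n (*-monoˡ-≤ m i≤N-1))

  B-window-injective : ∀ {i j} → i < N → j < N → cat (B ∘ (i +_)) t ≡ cat (B ∘ (j +_)) t → i ≡ j
  B-window-injective i<N j<N eq =
    window-injective i<N j<N (trans (sym (window≡ _ i<N)) (trans eq (window≡ _ j<N)))

  B-window-surjective : ∀ {x} → x WordOver Σ → length x ≡ t * m → ∃ λ i → i < N × x ≡ cat (B ∘ (i +_)) t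
  B-window-surjective x∈ lx with i , i<N , eq ← window-surjective x∈ lx =
    i , i<N , trans eq (sym (window≡ i i<N))

  B-initial : ∀ j → j < t → B j ≡ 0^ m
  B-initial = cat-0^⁻ t (λ i i<t → length-B i (≤-trans i<t (m≤n+m t N))) (trans (window≡ 0 z<s) zeros)

  -- By `suffix≡prefix`, the part of `τ` from letter N m on repeats only `p` = n - m letters of the
  -- zero prefix. The appended `m` zeros complete it to a full zero window, which closes the cycle.
  drop-w : drop (N * m) w ≡ 0^ n
  drop-w = begin
    drop (N * m) w               ≡⟨ drop-++ˡ (N * m) τ (0^ m) Nm≤τ ⟩
    drop (N * m) τ ++ 0^ m       ≡⟨ cong (_++ 0^ m) suffix≡prefix ⟩
    take p τ ++ 0^ m             ≡⟨ cong (λ x → take x τ ++ 0^ m) (m≤n⇒m⊓n≡m (m≤n+m p m)) ⟨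
    take (p ⊓ n) τ ++ 0^ m       ≡⟨ cong (_++ 0^ m) (take-take p n τ) ⟨
    take p (take n τ) ++ 0^ m    ≡⟨ cong (λ x → take p x ++ 0^ m) (trans zeros (cong 0^_ (+-comm m p))) ⟩
    take p (0^ (p + m)) ++ 0^ m  ≡⟨ cong (_++ 0^ m) (take-0^ p m) ⟩
    0^ p ++ 0^ m                 ≡⟨ 0^-+ p m ⟨
    0^ (p + m)                   ≡⟨ cong 0^_ (+-comm p m) ⟩
    0^ n                         ∎
    where
    open ≡-Reasoning
    Nm≤τ : N * m ≤ length τ
    Nm≤τ = ≤-trans (≤-reflexive (+-comm m (N-1 * m)))
      (≤-trans (+-monoʳ-≤ (N-1 * m) (m≤m+n m p)) (≤-reflexive (sym length-τ)))

  B-final : ∀ j → j < t → B (N + j) ≡ 0^ m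
  B-final = cat-0^⁻ t (λ i i<t → length-B (N + i) (+-monoʳ-< N i<t)) (begin
    cat (B ∘ (N +_)) t         ≡⟨ cat-block-shift m w N t ⟩
    take n (drop (N * m) w)    ≡⟨ cong (take n) (trans drop-w (cong 0^_ (sym (+-identityʳ n)))) ⟩
    take n (0^ (n + 0))        ≡⟨ take-0^ n 0 ⟩
    0^ n                       ∎)
    where open ≡-Reasoning

-- All that the interleaving uses of w₁ and w₂. `initial` and `final` express periodicity: the `t`
-- zero blocks at index 0 return at index `N`. Lengths are bounded to `j < N + t` because `block` is
-- truncated past the end of the word.
record IsBlockSequence (Σ : List ℕ) (m t N : ℕ) (B : ℕ → Word) : Set where
  field
    over              : ∀ j → B j WordOver Σ
    length-block≡     : ∀ j → j < N + t → length (B j) ≡ m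
    initial           : ∀ j → j < t → B j ≡ 0^ m
    final             : ∀ j → j < t → B (N + j) ≡ 0^ m
    window-injective  : ∀ {i j} → i < N → j < N → cat (B ∘ (i +_)) t ≡ cat (B ∘ (j +_)) t → i ≡ j
    window-surjective : ∀ {x} → x WordOver Σ → length x ≡ t * m → ∃ λ i → i < N × cat (B ∘ (i +_)) t ≡ x

isBlockSequence : ∀ {Σ m t N τ} .{{_ : NonZero m}} .{{_ : NonZero t}} →
                  0 ∈ Σ → 0 < N → N ≡ length Σ ^ (t * m) →
                  IsShiftDeBruijn Σ m (t * m) τ → τ [ 1 ⋯ t * m ] ≡ 0^ (t * m) →
                  IsBlockSequence Σ m t N (block m (τ ++ 0^ m))
isBlockSequence {t = suc t-1} {suc _} 0∈Σ _ N≡ τ-dB zeros = record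
  { over = B-over
  ; length-block≡ = length-B
  ; initial = B-initial
  ; final = B-final
  ; window-injective = B-window-injective
  ; window-surjective = λ x∈ lx → let i , i<N , eq = B-window-surjective x∈ lx in i , i<N , sym eq
  }
  where open Blocks {t-1 = t-1} 0∈Σ N≡ τ-dB zeros

-- Position i of the word carries window α i of w₁ and window i % M of w₂;
-- here P = N₁ − 1 and M = N₂.
module PairIndex (P M : ℕ) .{{_ : NonZero P}} .{{_ : NonZero M}} (cop : Coprime P M) where

  α : ℕ → ℕ
  α i with i <? M
  ... | yes _ = 0
  ... | no  _ = suc ((i ∸ M) % P)

  α-< : ∀ {i} → i < M → α i ≡ 0
  α-< {i} i<M with i <? M
  ... | yes _   = refl
  ... | no  i≮M = contradiction i<M i≮M

  α-≥ : ∀ j → α (M + j) ≡ suc (j % P)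
  α-≥ j with M + j <? M
  ... | yes M+j<M = contradiction M+j<M (≤⇒≯ (m≤m+n M j))
  ... | no  _     = cong (λ x → suc (x % P)) (m+n∸m≡n M j)

  data Position : ℕ → Set where
    early : ∀ {i} → i < M → Position i
    late  : ∀ j → Position (M + j)

  position : ∀ i → Position i
  position i with i <? M
  ... | yes i<M = early i<M
  ... | no  i≮M = subst Position (m+[n∸m]≡n (≮⇒≥ i≮M)) (late (i ∸ M))

  [M+j]%M : ∀ j → (M + j) % M ≡ j % M
  [M+j]%M j = trans (cong (_% M) (+-comm M j)) ([m+n]%n≡m%n j M)

  α-bound : ∀ i → α i < suc P
  α-bound i with position i
  ... | early i<M = subst (_< suc P) (sym (α-< i<M)) z<s
  ... | late j    = subst (_< suc P) (sym (α-≥ j)) (s<s (m%n<n j P))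

  -- `α` is zero exactly at the early positions, so the two phases cannot collide. Early positions
  -- are their own residues modulo `M`; late ones are separated by the Chinese remainder theorem.
  pair-injective : ∀ {i j} → i < M + P * M → j < M + P * M → α i ≡ α j → i % M ≡ j % M → i ≡ j
  pair-injective {i} {j} i< j< eqα eqM with position i | position j
  ... | early i<M | early j<M = trans (sym (m<n⇒m%n≡m i<M)) (trans eqM (m<n⇒m%n≡m j<M))
  ... | early i<M | late j′   = contradiction (trans (sym (α-< i<M)) (trans eqα (α-≥ j′))) 0≢1+n
  ... | late i′   | early j<M = contradiction (trans (sym (α-< j<M)) (trans (sym eqα) (α-≥ i′))) 0≢1+n
  ... | late i′   | late j′   = cong (M +_) (crt-uniqueness P M cop
    (+-cancelˡ-< M i′ (P * M) i<) (+-cancelˡ-< M j′ (P * M) j<)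
    (suc-injective (trans (sym (α-≥ i′)) (trans eqα (α-≥ j′))))
    (trans (sym ([M+j]%M i′)) (trans eqM ([M+j]%M j′))))

  pair-surjective : ∀ {p q} → p < suc P → q < M → ∃ λ i → i < M + P * M × α i ≡ p × i % M ≡ q
  pair-surjective {zero} {q} _ q<M =
    q , <-≤-trans q<M (m≤m+n M (P * M)) , α-< q<M , m<n⇒m%n≡m q<M
  pair-surjective {suc p} (s<s p<P) q<M with j , j< , refl , refl ← crt-existence P M cop p<P q<M =
    M + j , +-monoʳ-< M j< , α-≥ j , [M+j]%M j

-- Interleaving two block sequences

module Interleave
  {Σ : List ℕ} {r s k P M : ℕ} {Y Z : ℕ → Word} .{{_ : NonZero r}} .{{_ : NonZero P}} .{{_ : NonZero M}}
  (PM≡ : suc P * M ≡ length Σ ^ (r + k * (s + r)))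
  (cop : Coprime P M) (k≤P : k ≤ P) (k≤M : k ≤ M)
  (Y-seq : IsBlockSequence Σ r (suc k) (suc P) Y)
  (Z-seq : IsBlockSequence Σ s k M Z) where

  open PairIndex P M cop
  private
    module Y = IsBlockSequence Y-seq
    module Z = IsBlockSequence Z-seq

  U V : ℕ → Word
  U j = Y (α j)
  V j = Z (j % M)

  -- The successor skips block 0, so that P blocks remain in the cycle. It still closes, since the
  -- blocks `Y (suc P + j)` and `Y (suc j)` with `j < k` are all zero.
  Y-wrap : ∀ p → p < P + k → Y (suc (p % P)) ≡ Y (suc p)
  Y-wrap = %-wraparound {f = Y ∘ suc} P k k≤P λ j j<k →
    trans (Y.final j (m<n⇒m<1+n j<k)) (sym (Y.initial (suc j) (s<s j<k)))

  Z-wrap : ∀ p → p < M + k → Z (p % M) ≡ Z p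
  Z-wrap = %-wraparound {f = Z} M k k≤M λ j j<k → trans (Z.final j j<k) (sym (Z.initial j j<k))

  -- After the `M` early blocks, the shortened cycle starts with `Y 1` to `Y k`, which are zero too.
  -- The run is thus long enough for every window that starts before `M`.
  U-initial : ∀ j → j < M + k → U j ≡ 0^ r
  U-initial j j< with position j
  ... | early j<M = trans (cong Y (α-< j<M)) (Y.initial 0 z<s)
  ... | late j′   = begin
    Y (α (M + j′))       ≡⟨ cong Y (α-≥ j′) ⟩
    Y (suc (j′ % P))     ≡⟨ Y-wrap j′ (<-≤-trans j′<k (m≤n+m k P)) ⟩
    Y (suc j′)           ≡⟨ Y.initial (suc j′) (s<s j′<k) ⟩
    0^ r                 ∎
    where
    open ≡-Reasoning
    j′<k : j′ < k
    j′<k = +-cancelˡ-< M j′ k j<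

  U-late : ∀ p i → p + i % P < P + k → U (M + (p + i)) ≡ Y (suc (p + i % P))
  U-late p i bound = begin
    Y (α (M + (p + i)))           ≡⟨ cong Y (α-≥ (p + i)) ⟩
    Y (suc ((p + i) % P))         ≡⟨ cong (Y ∘ suc) ([m+n%d]%d≡[m+n]%d p i P) ⟨
    Y (suc ((p + i % P) % P))     ≡⟨ Y-wrap (p + i % P) bound ⟩
    Y (suc (p + i % P))           ∎
    where open ≡-Reasoning

  V≡ : ∀ p i → p + i % M < M + k → V (p + i) ≡ Z (p + i % M)
  V≡ p i bound = trans (cong Z (sym ([m+n%d]%d≡[m+n]%d p i M))) (Z-wrap (p + i % M) bound)

  %-+-bound : ∀ {p q} i d .{{_ : NonZero d}} → p ≤ q → p + i % d < d + q
  %-+-bound {p} {q} i d p≤q = subst (p + i % d <_) (+-comm q d) (+-mono-≤-< p≤q (m%n<n i d))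

  -- Only the first block of a window has its index given by `α i`; the others follow `U`, not
  -- consecutive blocks of `Y`. The two agree because every place where `U` jumps, at the change of
  -- phase or at the end of a round, lies at zero blocks on both sides of the comparison.
  U-window : ∀ i → cat (U ∘ (i +_)) (suc k) ≡ cat (Y ∘ (α i +_)) (suc k)
  U-window i with position i
  ... | early i<M = cat-cong (suc k) λ { t (s≤s t≤k) → begin
    U (i + t)        ≡⟨ U-initial (i + t) (+-mono-<-≤ i<M t≤k) ⟩
    0^ r             ≡⟨ Y.initial t (s≤s t≤k) ⟨
    Y t              ≡⟨ cong (λ x → Y (x + t)) (α-< i<M) ⟨
    Y (α i + t)      ∎ }
    where open ≡-Reasoning
  ... | late j    = cat-cong (suc k) λ { t (s≤s t≤k) → begin
    U (M + j + t)              ≡⟨ cong U (trans (+-assoc M j t) (cong (M +_) (+-comm j t))) ⟩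
    U (M + (t + j))            ≡⟨ U-late t j (%-+-bound j P t≤k) ⟩
    Y (suc (t + j % P))        ≡⟨ cong (Y ∘ suc) (+-comm t (j % P)) ⟩
    Y (suc (j % P) + t)        ≡⟨ cong (λ x → Y (x + t)) (α-≥ j) ⟨
    Y (α (M + j) + t)          ∎ }
    where open ≡-Reasoning

  V-window : ∀ i → cat (V ∘ (i +_)) k ≡ cat (Z ∘ (i % M +_)) k
  V-window i = cat-cong k λ t t<k → begin
    V (i + t)          ≡⟨ cong V (+-comm i t) ⟩
    V (t + i)          ≡⟨ V≡ t i (%-+-bound i M (<⇒≤ t<k)) ⟩
    Z (t + i % M)      ≡⟨ cong Z (+-comm t (i % M)) ⟩
    Z (i % M + t)      ∎
    where open ≡-Reasoning

  length-U : ∀ j → length (U j) ≡ r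
  length-U j = Y.length-block≡ (α j) (<-≤-trans (α-bound j) (m≤m+n (suc P) (suc k)))

  length-V : ∀ j → length (V j) ≡ s
  length-V j = Z.length-block≡ (j % M) (<-≤-trans (m%n<n j M) (m≤m+n M k))

  -- `Q` is the last position of a window, so there are `suc Q` = (P + 1) M of them, as many as
  -- words of length `n`.
  Q m n : ℕ
  Q = pred (suc P * M)
  m = s + r
  n = r + k * m

  suc-Q : suc Q ≡ M + P * M
  suc-Q = suc-pred (suc P * M) {{m*n≢0 (suc P) M}}

  woven : Word
  woven = alt U V (Q + k)

  window : ℕ → Word
  window i = alt (U ∘ (i +_)) (V ∘ (i +_)) k

  factor≡window : ∀ {i} → i ≤ Q → take n (drop (i * m) woven) ≡ window i
  factor≡window {i} i≤Q = trans (cong (λ x → take n (drop (i * m) (alt U V x))) Q+k≡)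
                                (factor-alt U V i k (Q ∸ i) length-U length-V)
    where
    open ≡-Reasoning
    Q+k≡ : Q + k ≡ i + (k + (Q ∸ i))
    Q+k≡ = begin
      Q + k               ≡⟨ cong (_+ k) (m+[n∸m]≡n i≤Q) ⟨
      i + (Q ∸ i) + k     ≡⟨ +-assoc i (Q ∸ i) k ⟩
      i + (Q ∸ i + k)     ≡⟨ cong (i +_) (+-comm (Q ∸ i) k) ⟩
      i + (k + (Q ∸ i))   ∎

  window≡weave : ∀ i → window i ≡ weave k (cat (Y ∘ (α i +_)) (suc k)) (cat (Z ∘ (i % M +_)) k)
  window≡weave i = trans
    (alt≡weave (U ∘ (i +_)) (V ∘ (i +_)) k (length-U ∘ (i +_)) (length-V ∘ (i +_)))
    (cong₂ (weave k) (U-window i) (V-window i))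

  length-Y-window : ∀ i → length (cat (Y ∘ (α i +_)) (suc k)) ≡ suc k * r
  length-Y-window i = trans (cong length (sym (U-window i)))
                            (length-cat {U ∘ (i +_)} (suc k) λ t _ → length-U (i + t))

  length-Z-window : ∀ i → length (cat (Z ∘ (i % M +_)) k) ≡ k * s
  length-Z-window i = trans (cong length (sym (V-window i)))
                            (length-cat {V ∘ (i +_)} k λ t _ → length-V (i + t))

  window-injective : ∀ {i j} → i ≤ Q → j ≤ Q → window i ≡ window j → i ≡ j
  window-injective {i} {j} i≤Q j≤Q eq
    with eqY , eqZ ← weave-injective k (length-Y-window i) (length-Y-window j)
                                         (length-Z-window i) (length-Z-window j)
                       (trans (sym (window≡weave i)) (trans eq (window≡weave j)))
    = pair-injective (subst (i <_) suc-Q (s≤s i≤Q)) (subst (j <_) suc-Q (s≤s j≤Q))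
        (Y.window-injective (α-bound i) (α-bound j) eqY)
        (Z.window-injective (m%n<n i M) (m%n<n j M) eqZ)

  window-surjective : ∀ {x} → x WordOver Σ → length x ≡ n → ∃ λ i → i ≤ Q × x ≡ window i
  window-surjective x∈ lx
    with y , z , (y∈ , ly) , (z∈ , lz) , refl ← weave-surjective k _ x∈ lx
    with p , p< , refl ← Y.window-surjective y∈ ly
    with q , q< , refl ← Z.window-surjective z∈ lz
    with i , i< , refl , refl ← pair-surjective p< q<
    = i , s≤s⁻¹ (subst (i <_) (sym suc-Q) i<) , sym (window≡weave i)

  length-woven : length woven ≡ Q * m + n
  length-woven = trans (length-alt U V (Q + k) length-U length-V) (lemma r Q k m)
    where
    lemma : ∀ r Q k m → r + (Q + k) * m ≡ Q * m + (r + k * m)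
    lemma = solve-∀

  instance
    m-nonZero : NonZero m
    m-nonZero = >-nonZero (≤-trans (>-nonZero⁻¹ r) (m≤n+m r s))

  isShiftDeBruijn : IsShiftDeBruijn Σ m n woven
  isShiftDeBruijn = record
    { wordOver = All.++⁺ (Y.over (α 0)) (All.concat⁺ (All.applyUpTo⁺₂ _ (Q + k)
        λ j → All.++⁺ (Z.over (j % M)) (Y.over (α (suc j)))))
    ; lengthIs = sym (begin
        m * length Σ ^ n + n ∸ m    ≡⟨ cong (λ N → m * N + n ∸ m) PM≡ ⟨
        m * (suc P * M) + n ∸ m     ≡⟨ cong (λ N → m * N + n ∸ m) suc-Q ⟨
        m * suc Q + n ∸ m           ≡⟨ cong (_∸ m) (lemma m Q n) ⟩
        m + (Q * m + n) ∸ m         ≡⟨ m+n∸m≡n m (Q * m + n) ⟩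
        Q * m + n                   ≡⟨ length-woven ⟨
        length woven          ∎)
    ; appearsOnce = appears
    }
    where
    open ≡-Reasoning
    lemma : ∀ m Q n → m * suc Q + n ≡ m + (Q * m + n)
    lemma = solve-∀
    appears : ∀ x → x WordOver Σ → length x ≡ n → ∃! _≡_ (AppearsAtModulo m woven x)
    appears x x∈ lx with i , i≤Q , x≡ ← window-surjective x∈ lx =
      i , appears⁺ length-woven lx i≤Q (trans x≡ (sym (factor≡window i≤Q)))
        , λ app → let j≤Q , x≡′ = appears⁻ length-woven lx app in
                  window-injective i≤Q j≤Q (trans (sym x≡) (trans x≡′ (factor≡window j≤Q)))

  alt-0^ : ∀ t → alt (λ _ → 0^ r) (λ _ → 0^ s) t ≡ 0^ (r + t * m)
  alt-0^ t = begin
    0^ r ++ cat (λ _ → 0^ s ++ 0^ r) t   ≡⟨ cong (0^ r ++_) (cat-cong t λ _ _ → sym (0^-+ s r)) ⟩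
    0^ r ++ cat (λ _ → 0^ m) t           ≡⟨ cong (0^ r ++_) (cat-0^ m t) ⟩
    0^ r ++ 0^ (t * m)                   ≡⟨ 0^-+ r (t * m) ⟨
    0^ (r + t * m)                       ∎
    where open ≡-Reasoning

  module _ {u v : ℕ → Word} (u≡ : ∀ i → u (suc i) ≡ Y (suc k + i)) (v≡ : ∀ i → v (suc i) ≡ Z (k + i)) where

    private
      R : ℕ
      R = P * M ∸ 1
      -- Pairs are counted from the end of the leading `0^ n`, which consumes `k + 1` blocks of `U`
      -- and `k` of `V`.
      f : ℕ → Word
      f j = V (k + j) ++ U (suc (k + j))

    0<M : 0 < M
    0<M = >-nonZero⁻¹ M

    suc-M∸1 : suc (M ∸ 1) ≡ M
    suc-M∸1 = m+[n∸m]≡n 0<M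

    start≡ : alt U V k ≡ 0^ n
    start≡ = trans (alt-cong k
      (λ i i≤k → U-initial i (≤-trans i≤k (+-monoˡ-≤ k 0<M)))
      (λ i i<k → trans (Z-wrap i (<-≤-trans i<k (m≤n+m k M))) (Z.initial i i<k)))
      (alt-0^ k)

    early≡ : ∀ i → i < M ∸ 1 → f i ≡ v (suc i) ++ 0^ r
    early≡ i i< = cong₂ _++_
      (trans (Z-wrap (k + i) (<-trans (n<1+n (k + i)) bound)) (sym (v≡ i)))
      (U-initial (suc (k + i)) bound)
      where
      open ≤-Reasoning
      bound : suc (k + i) < M + k
      bound = begin-strict
        suc (k + i)         ≡⟨ cong suc (+-comm k i) ⟩
        suc i + k           <⟨ +-monoˡ-< k (s<s i<) ⟩
        suc (M ∸ 1) + k     ≡⟨ cong (_+ k) suc-M∸1 ⟩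
        M + k               ∎

    -- From pair `M ∸ 1` on, the `U`-block lies at offset k + i of the late phase, just past the k
    -- zero blocks that open the shortened cycle.
    shift : ∀ i → suc (k + ((M ∸ 1) + i)) ≡ M + (k + i)
    shift i = trans (lemma k (M ∸ 1) i) (cong (_+ (k + i)) suc-M∸1)
      where
      lemma : ∀ k m i → suc (k + (m + i)) ≡ suc m + (k + i)
      lemma = solve-∀

    U-final : ∀ i → U (suc (k + ((M ∸ 1) + i))) ≡ u (suc (i % P))
    U-final i = begin
      U (suc (k + ((M ∸ 1) + i)))    ≡⟨ cong U (shift i) ⟩
      U (M + (k + i))                ≡⟨ U-late k i (%-+-bound i P ≤-refl) ⟩
      Y (suc (k + i % P))            ≡⟨ u≡ (i % P) ⟨
      u (suc (i % P))                ∎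
      where open ≡-Reasoning

    middle≡ : f (M ∸ 1 + 0) ≡ v M ++ u (suc (P * M % P))
    middle≡ = cong₂ _++_
      (begin
        V (k + (M ∸ 1 + 0))            ≡⟨ cong (λ x → V (k + x)) (+-identityʳ (M ∸ 1)) ⟩
        V (k + (M ∸ 1))                ≡⟨ Z-wrap (k + (M ∸ 1)) last< ⟩
        Z (k + (M ∸ 1))                ≡⟨ v≡ (M ∸ 1) ⟨
        v (suc (M ∸ 1))                ≡⟨ cong v suc-M∸1 ⟩
        v M                            ∎)
      (trans (U-final 0) (cong (u ∘ suc) 0%P≡[P*M]%P))
      where
      open ≡-Reasoning
      last< : k + (M ∸ 1) < M + k
      last< = ≤-reflexive (trans (sym (+-suc k (M ∸ 1))) (trans (cong (k +_) suc-M∸1) (+-comm k M)))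
      -- The index (N₁ - 1) N₂ in the statement is a multiple of `P`, so this block is the first
      -- one, `u 1`.
      0%P≡[P*M]%P : 0 % P ≡ P * M % P
      0%P≡[P*M]%P = trans (m<n⇒m%n≡m (>-nonZero⁻¹ P))
        (sym (trans (cong (_% P) (*-comm P M)) (m*n%n≡0 M P)))

    -- The middle pair has already used `u 1` together with the last block of a round of `V`. Hence
    -- `V` restarts at `v 1` while `U` continues with `u 2`, which is why u′ is indexed by i and v′
    -- by i - 1.
    late≡ : ∀ i → f (M ∸ 1 + suc i) ≡ v (suc (i % M)) ++ u (suc (suc i % P))
    late≡ i = cong₂ _++_
      (begin
        V (k + (M ∸ 1 + suc i))        ≡⟨ cong (λ x → V (k + x)) (+-suc (M ∸ 1) i) ⟩
        V (k + suc (M ∸ 1 + i))        ≡⟨ cong V (trans (+-suc k _) (shift i)) ⟩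
        V (M + (k + i))                ≡⟨ cong Z ([M+j]%M (k + i)) ⟩
        V (k + i)                      ≡⟨ V≡ k i (%-+-bound i M ≤-refl) ⟩
        Z (k + i % M)                  ≡⟨ v≡ (i % M) ⟨
        v (suc (i % M))                ∎)
      (U-final (suc i))
      where open ≡-Reasoning

    Q+k≡ : Q + k ≡ k + (M ∸ 1 + suc R)
    Q+k≡ = trans (+-comm Q k) (cong (k +_) (suc-injective (begin
      suc Q                 ≡⟨ suc-Q ⟩
      M + P * M             ≡⟨ cong₂ _+_ suc-M∸1 (m+[n∸m]≡n (>-nonZero⁻¹ (P * M) {{m*n≢0 P M}})) ⟨
      suc (M ∸ 1) + suc R   ∎)))
      where open ≡-Reasoning

    woven≡ : woven ≡
      0^ n ++ cat (λ i → v (suc i) ++ 0^ r) (M ∸ 1) ++ v M ++ u (suc (P * M % P)) ++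
      cat (λ i → v (suc (i % M)) ++ u (suc (suc i % P))) R
    woven≡ = begin
      alt U V (Q + k)                              ≡⟨ cong (alt U V) Q+k≡ ⟩
      alt U V (k + (M ∸ 1 + suc R))                ≡⟨ alt-+ U V k (M ∸ 1 + suc R) ⟩
      alt U V k ++ cat f (M ∸ 1 + suc R)           ≡⟨ cong₂ _++_ start≡ (cat-+ f (M ∸ 1) (suc R)) ⟩
      0^ n ++ cat f (M ∸ 1) ++ f (M ∸ 1 + 0) ++ cat (λ i → f (M ∸ 1 + suc i)) R
        ≡⟨ cong (0^ n ++_) (cong₂ _++_ (cat-cong (M ∸ 1) early≡)
             (trans (cong₂ _++_ middle≡ (cat-cong R λ i _ → late≡ i)) (++-assoc (v M) _ _))) ⟩
      _ ∎
      where open ≡-Reasoning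

-- Parameters of the construction

n<a^n : ∀ {a} → 2 ≤ a → ∀ n → n < a ^ n
n<a^n 2≤a zero    = z<s
n<a^n {a} 2≤a (suc n) = begin-strict
  suc n          ≤⟨ n<a^n 2≤a n ⟩
  a ^ n          <⟨ ^-monoʳ-< a 2≤a (n<1+n n) ⟩
  a ^ suc n      ∎
  where open ≤-Reasoning

mainTheorem3 : (Σ : List ℕ) → Unique Σ → 0 ∈ Σ → (2≤a : 2 ≤ length Σ) →
    (m n k r : ℕ) .{{_ : NonZero m}} → m < n →
    n ≡ k * m + r → r ≡ n % m → (r≢0 : r ≢ 0) →
    (τ₁ τ₂ : Word) →
    let open Construction Σ 2≤a m n k r r≢0 τ₁ τ₂ in
    IsShiftDeBruijn Σ m₁ n₁ τ₁ → τ₁ [ 1 ⋯ n₁ ] ≡ 0^ n₁ →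
    IsShiftDeBruijn Σ m₂ n₂ τ₂ → τ₂ [ 1 ⋯ n₂ ] ≡ 0^ n₂ →
    IsShiftDeBruijn Σ m n word
mainTheorem3 Σ _ 0∈Σ 2≤a m n k r m<n n≡ r≡ r≢0 τ₁ τ₂ τ₁-dB τ₁-zeros τ₂-dB τ₂-zeros =
  subst (IsShiftDeBruijn Σ m n) (sym word≡)
    (subst₂ (λ m n → IsShiftDeBruijn Σ m n I.woven) m≡ n≡′ I.isShiftDeBruijn)
  where
  open ≡-Reasoning
  open Construction Σ 2≤a m n k r r≢0 τ₁ τ₂

  s P : ℕ
  s = m ∸ r
  P = N₁ ∸ 1

  r<m : r < m
  r<m = subst (_< m) (sym r≡) (m%n<n n m)

  k≢0 : k ≢ 0
  k≢0 refl = <-asym m<n (subst (_< m) (sym n≡) r<m)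

  m≡ : s + r ≡ m
  m≡ = m∸n+n≡m (<⇒≤ r<m)

  n≡′ : r + k * (s + r) ≡ n
  n≡′ = trans (+-comm r _) (trans (cong (λ x → k * x + r) m≡) (sym n≡))

  instance
    r-nonZero : NonZero r
    r-nonZero = ≢-nonZero r≢0
    k-nonZero : NonZero k
    k-nonZero = ≢-nonZero k≢0
    s-nonZero : NonZero s
    s-nonZero = >-nonZero (m<n⇒0<n∸m r<m)
    a-nonZero : NonZero a
    a-nonZero = >-nonZero (<-trans z<s 2≤a)

  k+1≡ : k + 1 ≡ suc k
  k+1≡ = +-comm k 1

  suc-P : suc P ≡ N₁
  suc-P = m+[n∸m]≡n (m^n>0 a n₁)

  n₁≡ : n₁ ≡ suc k * r
  n₁≡ = cong (_* r) k+1≡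

  n₁>0 : 0 < n₁
  n₁>0 = subst (0 <_) (sym n₁≡) (>-nonZero⁻¹ (suc k * r) {{m*n≢0 (suc k) r}})

  -- This bound and the next say that a window wraps at most once around either cycle; both come
  -- from k ≤ nⱼ < a ^ nⱼ.
  k≤P : k ≤ P
  k≤P = s≤s⁻¹ (≤-<-trans (≤-trans (n≤1+n k) (m≤m*n (suc k) r))
    (subst₂ _<_ n₁≡ (sym suc-P) (n<a^n 2≤a n₁)))

  k≤N₂ : k ≤ N₂
  k≤N₂ = ≤-trans (m≤m*n k s) (<⇒≤ (n<a^n 2≤a n₂))

  coprime : Coprime P N₂
  coprime = coprime-pred-^ a (pred n₁) n₂ (trans suc-P (cong (a ^_) (sym (suc-pred n₁ {{>-nonZero n₁>0}}))))

  PN₂≡ : suc P * N₂ ≡ a ^ (r + k * (s + r))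
  PN₂≡ = begin
    suc P * N₂                      ≡⟨ cong (_* N₂) suc-P ⟩
    a ^ n₁ * a ^ n₂                 ≡⟨ ^-distribˡ-+-* a n₁ n₂ ⟨
    a ^ (n₁ + n₂)                   ≡⟨ cong (a ^_) (lemma k r s) ⟩
    a ^ (r + k * (s + r))           ∎
    where
    lemma : ∀ k r s → (k + 1) * r + k * s ≡ r + k * (s + r)
    lemma = solve-∀

  Y-seq : IsBlockSequence Σ r (suc k) (suc P) (block r w₁)
  Y-seq = isBlockSequence 0∈Σ z<s (trans suc-P (cong (a ^_) n₁≡))
    (subst (λ n → IsShiftDeBruijn Σ r n τ₁) n₁≡ τ₁-dB)
    (subst (λ n → τ₁ [ 1 ⋯ n ] ≡ 0^ n) n₁≡ τ₁-zeros)

  Z-seq : IsBlockSequence Σ s k N₂ (block s w₂)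
  Z-seq = isBlockSequence 0∈Σ (m^n>0 a n₂) refl τ₂-dB τ₂-zeros

  module I = Interleave PN₂≡ coprime k≤P k≤N₂ Y-seq Z-seq

  -- Both n₁ and n₂ are whole numbers of blocks, so the factors that define `u` and `v` are aligned
  -- blocks, counted after the zero prefix.
  factor≡block : ∀ t ℓ w i → w [ t * ℓ + i * ℓ + 1 ⋯ t * ℓ + suc i * ℓ ] ≡ block ℓ w (t + i)
  factor≡block t ℓ w i = begin
    w [ t * ℓ + i * ℓ + 1 ⋯ t * ℓ + suc i * ℓ ]   ≡⟨ cong (λ x → w [ t * ℓ + i * ℓ + 1 ⋯ x ]) (lemma t ℓ i) ⟩
    w [ t * ℓ + i * ℓ + 1 ⋯ t * ℓ + i * ℓ + ℓ ]   ≡⟨ factor≡ w (t * ℓ + i * ℓ) ℓ ⟩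
    take ℓ (drop (t * ℓ + i * ℓ) w)               ≡⟨ cong (λ x → take ℓ (drop x w)) (*-distribʳ-+ ℓ t i) ⟨
    block ℓ w (t + i)                             ∎
    where
    lemma : ∀ t ℓ i → t * ℓ + suc i * ℓ ≡ t * ℓ + i * ℓ + ℓ
    lemma = solve-∀

  word≡ : word ≡ I.woven
  word≡ = sym (trans
    (I.woven≡ {u} {v} (λ i → trans (factor≡block (k + 1) r w₁ i) (cong (λ t → block r w₁ (t + i)) k+1≡))
                      (factor≡block k s w₂))
    -- Apart from the exponent of the leading zeros, the two sides agree by computation: indices
    -- from 1 become successors, and `i ∸ 1` reduces.
    (cong₂ _++_ (cong 0^_ n≡′) refl))
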